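{- The pair $(L_{(123)},L_{(132)})$ belongs to $OLS_3$, and every element of $OLS_3$ is $\sim'$-equivalent to $(L_{(123)},L_{(132)})$; i.e. $OLS_3/\sim'$ has exactly one element.
   Context: A Latin square of size $k$ is a $k\times k$ array with entries in $\{1,\dots,k\}$ with no repetition in any row or column. For a $k$-cycle $\sigma\in\text{Sym}_k$, $L_\sigma$ denotes the Latin square whose first row is $(1,2,\dots,k)$ and whose row $i+1$ is obtained by applying $\sigma$ entrywise to row $i$. Two Latin squares $L,L'$ are orthogonal if $(i,j)\mapsto(L_{ij},L'_{ij})$ is a bijection of $\{1,\dots,k\}^2$; $OLS_k$ is the set of ordered orthogonal pairs of size $k$. $(L_1,L_2)\sim'(L_1',L_2')$ means one can pass from one pair to the other by a finite sequence of: (R1) exchange rows $i$ and $j$ in both squares; (R2) exchange columns $i$ and $j$ in both squares; (R3) exchange two symbols in the first square; (R4) exchange two symbols in the second square; (R5) transpose one of the squares; (R6) swap the two squares. -}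

module Defs where

open import Data.Nat using (ℕ; zero; suc)
open import Data.Fin using (Fin; zero; suc; _≟_)
open import Data.Product using (_×_; _,_; proj₁; proj₂)
open import Data.Sum using (_⊎_)
open import Relation.Nullary using (yes; no)
open import Relation.Binary.PropositionalEquality using (_≡_)
open import Relation.Binary.Construct.Closure.ReflexiveTransitive using (Star)
open import Function.Definitions using (Injective; Bijective)

-- Symbols, rows and columns are indexed by Fin k (0-based: entry m ↔ symbol m+1).
Square : ℕ → Set
Square k = Fin k → Fin k → Fin k

IsLatin : ∀ {k} → Square k → Set
IsLatin {k} L = (∀ i → Injective _≡_ _≡_ (λ j → L i j))
              × (∀ j → Injective _≡_ _≡_ (λ i → L i j))

Orthogonal : ∀ {k} → Square k → Square k → Set
Orthogonal {k} L L' =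
  Bijective {A = Fin k × Fin k} {B = Fin k × Fin k} _≡_ _≡_
            (λ p → L (proj₁ p) (proj₂ p) , L' (proj₁ p) (proj₂ p))

Pair : ℕ → Set
Pair k = Square k × Square k

OLS : (k : ℕ) → Pair k → Set
OLS k (L₁ , L₂) = IsLatin L₁ × IsLatin L₂ × Orthogonal L₁ L₂

iter : ∀ {k} → (Fin k → Fin k) → ℕ → Fin k → Fin k
iter σ zero x = x
iter σ (suc n) x = σ (iter σ n x)

-- L_σ : first row (1,…,k), row i+1 = σ applied entrywise to row i;
-- hence entry (i,j) is σ^i(j).
Lσ : ∀ {k} → (Fin k → Fin k) → Square k
Lσ σ i j = iter σ (Data.Fin.toℕ i) j

σ123 : Fin 3 → Fin 3
σ123 zero = suc zero
σ123 (suc zero) = suc (suc zero)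
σ123 (suc (suc zero)) = zero

σ132 : Fin 3 → Fin 3
σ132 zero = suc (suc zero)
σ132 (suc zero) = zero
σ132 (suc (suc zero)) = suc zero

swapFin : ∀ {k} → Fin k → Fin k → Fin k → Fin k
swapFin a b x with x ≟ a
... | yes _ = b
... | no _ with x ≟ b
...   | yes _ = a
...   | no _ = x

transpose : ∀ {k} → Square k → Square k
transpose L i j = L j i

_≐_ : ∀ {k} → Pair k → Pair k → Set
(A₁ , A₂) ≐ (B₁ , B₂) = (∀ i j → A₁ i j ≡ B₁ i j) × (∀ i j → A₂ i j ≡ B₂ i j)

data Move {k : ℕ} : Pair k → Pair k → Set where
  R1 : ∀ {p q} (a b : Fin k) →
       q ≐ ((λ i j → proj₁ p (swapFin a b i) j) , (λ i j → proj₂ p (swapFin a b i) j)) → Move p q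
  R2 : ∀ {p q} (a b : Fin k) →
       q ≐ ((λ i j → proj₁ p i (swapFin a b j)) , (λ i j → proj₂ p i (swapFin a b j))) → Move p q
  R3 : ∀ {p q} (a b : Fin k) →
       q ≐ ((λ i j → swapFin a b (proj₁ p i j)) , proj₂ p) → Move p q
  R4 : ∀ {p q} (a b : Fin k) →
       q ≐ (proj₁ p , (λ i j → swapFin a b (proj₂ p i j))) → Move p q
  R5₁ : ∀ {p q} → q ≐ (transpose (proj₁ p) , proj₂ p) → Move p q
  R5₂ : ∀ {p q} → q ≐ (proj₁ p , transpose (proj₂ p)) → Move p q
  R6 : ∀ {p q} → q ≐ (proj₂ p , proj₁ p) → Move p q

_∼′_ : ∀ {k} → Pair k → Pair k → Set
_∼′_ = Star Move

{-# OPTIONS --safe #-}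

-- Relabelling the symbols of each square makes both first rows (1,2,3).  The other
-- two rows of such a square are derangements of {1,2,3}, i.e. the two 3-cycles in some
-- order, so each square is L_(123) or L_(132).  Orthogonality excludes that they are
-- equal, and exchanging the squares identifies the two remaining pairs.
module Submission where

open import Defs
open import Data.Fin using (Fin; _≟_)
open import Data.Fin.Patterns using (0F; 1F; 2F)
open import Data.Fin.Properties using (all?; any?)
open import Data.Product using (_×_; _,_; proj₁; ∃₂)
open import Data.Product.Properties using (,-injectiveˡ; ,-injectiveʳ)
open import Data.Sum as Sum using (_⊎_; inj₁; inj₂)
open import Function using (_∘_; id)
open import Function.Definitions using (Injective)
open import Relation.Binary.Construct.Closure.ReflexiveTransitive using (ε; _◅_; _◅◅_)
open import Relation.Binary.PropositionalEquality using (_≡_; _≢_; _≗_; refl; sym; trans; cong; cong₂)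
open import Relation.Nullary using (Dec; yes; no; ¬?; contradiction)
open import Relation.Nullary.Decidable using (from-yes; map′; _×-dec_; _⊎-dec_; _→-dec_)

Inj : {A B : Set} → (A → B) → Set
Inj = Injective _≡_ _≡_

isLatin? : ∀ {k} (L : Square k) → Dec (IsLatin L)
isLatin? L = all? (λ i → injective? (L i)) ×-dec all? (λ j → injective? (λ i → L i j))
  where
  injective? : ∀ {m n} (f : Fin m → Fin n) → Dec (Inj f)
  injective? f = map′ (λ inj {x} {y} → inj x y) (λ inj x y → inj {x} {y})
    (all? λ x → all? λ y → (f x ≟ f y) →-dec (x ≟ y))

superpose : ∀ {k} → Pair k → Fin k × Fin k → Fin k × Fin k
superpose (L , L′) (i , j) = L i j , L′ i j

-- Bijectivity on pairs of indices is curried into statements about single coordinates, which `all?`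
-- and `any?` settle by finite search.
orthogonal? : ∀ {k} (L L′ : Square k) → Dec (Orthogonal L L′)
orthogonal? L L′ = map′ to from
  ((all? λ i → all? λ j → all? λ i′ → all? λ j′ →
     (L i j ≟ L i′ j′) →-dec (L′ i j ≟ L′ i′ j′) →-dec ((i ≟ i′) ×-dec (j ≟ j′)))
   ×-dec
   (all? λ x → all? λ y → any? λ i → any? λ j → (L i j ≟ x) ×-dec (L′ i j ≟ y)))
  where
  Curried : Set
  Curried = (∀ i j i′ j′ → L i j ≡ L i′ j′ → L′ i j ≡ L′ i′ j′ → i ≡ i′ × j ≡ j′)
          × (∀ x y → ∃₂ λ i j → L i j ≡ x × L′ i j ≡ y)

  to : Curried → Orthogonal L L′
  to (inj , surj) =
    (λ {(i , j)} {(i′ , j′)} eq →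
      let i≡ , j≡ = inj i j i′ j′ (,-injectiveˡ eq) (,-injectiveʳ eq) in cong₂ _,_ i≡ j≡) ,
    (λ (x , y) →
      let i , j , x≡ , y≡ = surj x y in (i , j) , λ { refl → cong₂ _,_ x≡ y≡ })

  from : Orthogonal L L′ → Curried
  from (inj , surj) =
    (λ i j i′ j′ x≡ y≡ →
      let eq = inj (cong₂ _,_ x≡ y≡) in ,-injectiveˡ eq , ,-injectiveʳ eq) ,
    (λ x y →
      let (i , j) , eq = surj (x , y) in i , j , ,-injectiveˡ (eq refl) , ,-injectiveʳ (eq refl))

swapFin-left : ∀ {k} (a b : Fin k) → swapFin a b a ≡ b
swapFin-left a b with a ≟ a
... | yes _  = refl
... | no a≢a = contradiction refl a≢a

swapFin-right : ∀ {k} (a b : Fin k) → swapFin a b b ≡ a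
swapFin-right a b with b ≟ a
-- `swapFin` compares with `a` first, so if the two symbols coincide it returns `b`, and the test
-- itself supplies the equation.
... | yes b≡a = b≡a
... | no _ with b ≟ b
...   | yes _  = refl
...   | no b≢b = contradiction refl b≢b

swapFin-other : ∀ {k} {a b x : Fin k} → x ≢ a → x ≢ b → swapFin a b x ≡ x
swapFin-other {a = a} {b} {x} x≢a x≢b with x ≟ a
... | yes x≡a = contradiction x≡a x≢a
... | no _ with x ≟ b
...   | yes x≡b = contradiction x≡b x≢b
...   | no _    = refl

swapFin-involutive : ∀ {k} (a b x : Fin k) → swapFin a b (swapFin a b x) ≡ x
swapFin-involutive a b x with x ≟ a
... | yes x≡a = trans (swapFin-right a b) (sym x≡a)
... | no x≢a with x ≟ b
...   | yes x≡b = trans (swapFin-left a b) (sym x≡b)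
...   | no x≢b  = swapFin-other x≢a x≢b

swapFin-injective : ∀ {k} (a b : Fin k) → Inj (swapFin a b)
swapFin-injective a b {x} {y} eq =
  trans (sym (swapFin-involutive a b x)) (trans (cong (swapFin a b) eq) (swapFin-involutive a b y))

-- Meant as the inverse of an injective `f`, but written as two exchanges so that each factor is a
-- single R3 or R4 move. The first carries `f 0F` to `0F`; the second takes wherever `f 1F` has
-- landed to `1F`.
relabel : (f : Fin 3 → Fin 3) → Fin 3 → Fin 3
relabel f = swapFin (swapFin (f 0F) 0F (f 1F)) 1F ∘ swapFin (f 0F) 0F

relabel-injective : ∀ f → Inj (relabel f)
relabel-injective f = swapFin-injective (f 0F) 0F ∘ swapFin-injective (swapFin (f 0F) 0F (f 1F)) 1F

fixes-two⇒id : (f : Fin 3 → Fin 3) → Inj f → f 0F ≡ 0F → f 1F ≡ 1F → f ≗ id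
fixes-two⇒id f inj f0 f1 0F = f0
fixes-two⇒id f inj f0 f1 1F = f1
fixes-two⇒id f inj f0 f1 2F with f 2F in f2
... | 0F with () ← inj (trans f2 (sym f0))
... | 1F with () ← inj (trans f2 (sym f1))
... | 2F = refl

-- The second exchange does not disturb `0F`, which is neither `1F` nor the landing place `c` of
-- `f 1F`. The composite is injective with two fixed points, which forces the third.
relabel-inverse : (f : Fin 3 → Fin 3) → Inj f → relabel f ∘ f ≗ id
relabel-inverse f inj = fixes-two⇒id (relabel f ∘ f) (inj ∘ relabel-injective f) fix0 fix1
  where
  c : Fin 3
  c = swapFin (f 0F) 0F (f 1F)

  0≢c : 0F ≢ c
  0≢c 0≡c with () ← inj (swapFin-injective (f 0F) 0F (trans (swapFin-left (f 0F) 0F) 0≡c))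

  fix0 : relabel f (f 0F) ≡ 0F
  fix0 = trans (cong (swapFin c 1F) (swapFin-left (f 0F) 0F)) (swapFin-other 0≢c λ ())

  fix1 : relabel f (f 1F) ≡ 1F
  fix1 = swapFin-left c 1F

derangement-cases : (f : Fin 3 → Fin 3) → Inj f → (∀ j → f j ≢ j) → f ≗ σ123 ⊎ f ≗ σ132
derangement-cases f inj f≢ =
  Sum.map pointwise pointwise
    (byValues (f 0F) (f 1F) (f 2F) (f≢ 0F) (f≢ 1F) (f≢ 2F)
      (λ eq → contradiction (inj eq) λ ()) (λ eq → contradiction (inj eq) λ ())
      (λ eq → contradiction (inj eq) λ ()))
  where
  pointwise : ∀ {σ} → f 0F ≡ σ 0F × f 1F ≡ σ 1F × f 2F ≡ σ 2F → f ≗ σ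
  pointwise (p , q , r) 0F = p
  pointwise (p , q , r) 1F = q
  pointwise (p , q , r) 2F = r

  byValues : ∀ x y z → x ≢ 0F → y ≢ 1F → z ≢ 2F → x ≢ y → x ≢ z → y ≢ z →
             (x ≡ 1F × y ≡ 2F × z ≡ 0F) ⊎ (x ≡ 2F × y ≡ 0F × z ≡ 1F)
  -- The function enters only through its three values, so checking all 27 triples suffices.
  byValues = from-yes (all? {3} λ x → all? {3} λ y → all? {3} λ z →
    ¬? (x ≟ 0F) →-dec ¬? (y ≟ 1F) →-dec ¬? (z ≟ 2F) →-dec
    ¬? (x ≟ y) →-dec ¬? (x ≟ z) →-dec ¬? (y ≟ z) →-dec
    (((x ≟ 1F) ×-dec (y ≟ 2F) ×-dec (z ≟ 0F)) ⊎-dec ((x ≟ 2F) ×-dec (y ≟ 0F) ×-dec (z ≟ 1F))))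

_≗₂_ : ∀ {k} → Square k → Square k → Set
L ≗₂ M = ∀ i j → L i j ≡ M i j

reduced-cases : (L : Square 3) → IsLatin L → L 0F ≗ id → L ≗₂ Lσ σ123 ⊎ L ≗₂ Lσ σ132
reduced-cases L (rows , cols) row0
  with derangement-cases (L 1F) (rows 1F) (deranged λ ()) | derangement-cases (L 2F) (rows 2F) (deranged λ ())
  where
  deranged : ∀ {i} → i ≢ 0F → ∀ j → L i j ≢ j
  -- A symbol `j` in column `j` would repeat the entry of the top row there.
  deranged i≢0 j eq = i≢0 (cols j (trans eq (sym (row0 j))))
-- Two equal lower rows clash already in column `0F`.
... | inj₁ r₁ | inj₁ r₂ with () ← cols 0F (trans (r₁ 0F) (sym (r₂ 0F)))
... | inj₂ r₁ | inj₂ r₂ with () ← cols 0F (trans (r₁ 0F) (sym (r₂ 0F)))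
-- Row `2F` of `Lσ σ123` is `σ123` applied twice; this computes to `σ132` only at a concrete column,
-- hence the split of the last row.
... | inj₁ r₁ | inj₂ r₂ = inj₁ λ where
  0F j  → row0 j
  1F j  → r₁ j
  2F 0F → r₂ 0F
  2F 1F → r₂ 1F
  2F 2F → r₂ 2F
... | inj₂ r₁ | inj₁ r₂ = inj₂ λ where
  0F j  → row0 j
  1F j  → r₁ j
  2F 0F → r₂ 0F
  2F 1F → r₂ 1F
  2F 2F → r₂ 2F

mapSymbols : ∀ {k} → (Fin k → Fin k) → Square k → Square k
mapSymbols π L i j = π (L i j)

mapSymbols-latin : ∀ {k} {π : Fin k → Fin k} {L : Square k} → Inj π → IsLatin L → IsLatin (mapSymbols π L)
mapSymbols-latin π-inj (rows , cols) = (λ i → rows i ∘ π-inj) , (λ j → cols j ∘ π-inj)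

mapSymbols-superpose : ∀ {k} {π ρ : Fin k → Fin k} {L L′ : Square k} → Inj π → Inj ρ →
  Inj (superpose (L , L′)) → Inj (superpose (mapSymbols π L , mapSymbols ρ L′))
mapSymbols-superpose π-inj ρ-inj inj eq =
  inj (cong₂ _,_ (π-inj (,-injectiveˡ eq)) (ρ-inj (,-injectiveʳ eq)))

≐-refl : ∀ {k} {p : Pair k} → p ≐ p
≐-refl = (λ _ _ → refl) , (λ _ _ → refl)

relabel-∼′ : ∀ f g (L L′ : Square 3) → (L , L′) ∼′ (mapSymbols (relabel f) L , mapSymbols (relabel g) L′)
relabel-∼′ f g L L′ =
  R3 (f 0F) 0F ≐-refl ◅ R3 (swapFin (f 0F) 0F (f 1F)) 1F ≐-refl ◅
  R4 (g 0F) 0F ≐-refl ◅ R4 (swapFin (g 0F) 0F (g 1F)) 1F ≐-refl ◅ ε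

reduced-∼′ : (L L′ : Square 3) → IsLatin L → IsLatin L′ → Inj (superpose (L , L′)) →
  L 0F ≗ id → L′ 0F ≗ id → (L , L′) ∼′ (Lσ σ123 , Lσ σ132)
reduced-∼′ L L′ lat lat′ inj row0 row0′ with reduced-cases L lat row0 | reduced-cases L′ lat′ row0′
-- Move permits pointwise-equal targets, so a double exchange absorbs the equality.
... | inj₁ e | inj₂ e′ = R6 ≐-refl ◅ R6 ((λ i j → sym (e i j)) , (λ i j → sym (e′ i j))) ◅ ε
... | inj₂ e | inj₁ e′ = R6 ((λ i j → sym (e′ i j)) , (λ i j → sym (e i j))) ◅ ε
-- Cells (0,1) and (1,0) of `Lσ σ123` both hold `1F`, so the superposition would repeat a pair.
... | inj₁ e | inj₁ e′
  with () ← inj {0F , 1F} {1F , 0F} (cong₂ _,_ (trans (e 0F 1F) (sym (e 1F 0F))) (trans (e′ 0F 1F) (sym (e′ 1F 0F))))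
-- In `Lσ σ132` the symbol `1F` recurs at cells (0,1) and (1,2) instead.
... | inj₂ e | inj₂ e′
  with () ← inj {0F , 1F} {1F , 2F} (cong₂ _,_ (trans (e 0F 1F) (sym (e 1F 2F))) (trans (e′ 0F 1F) (sym (e′ 1F 2F))))

theorem3p4 : OLS 3 (Lσ σ123 , Lσ σ132)
    × (∀ (p : Pair 3) → OLS 3 p → p ∼′ (Lσ σ123 , Lσ σ132))
theorem3p4 =
  ( from-yes (isLatin? (Lσ σ123))
  , from-yes (isLatin? (Lσ σ132))
  , from-yes (orthogonal? (Lσ σ123) (Lσ σ132))) ,
  λ (L , L′) (lat , lat′ , inj , _) →
    -- Each square is normalised by its own first row, injective by the Latin property. Relabelling
    -- keeps both squares Latin and the superposition injective, so the reduced case applies.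
    relabel-∼′ (L 0F) (L′ 0F) L L′ ◅◅
    reduced-∼′ _ _
      (mapSymbols-latin (relabel-injective (L 0F)) lat)
      (mapSymbols-latin (relabel-injective (L′ 0F)) lat′)
      (mapSymbols-superpose (relabel-injective (L 0F)) (relabel-injective (L′ 0F)) inj)
      (relabel-inverse (L 0F) (proj₁ lat 0F))
      (relabel-inverse (L′ 0F) (proj₁ lat′ 0F))
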